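{- 1) For every positive integer $n$ with $n\not\equiv \pm 3 \pmod 9$, one has $\nu(n)\geq 1$. 2) For every positive integer $n$ with $n\equiv \pm 3 \pmod 9$, one has $\nu(n)=0$.
   Context: Let $F(x,y,z)=x^3+y^3+z^3-3xyz$. For a positive integer $n$, $\nu(n)$ denotes the number of triples of integers $(x,y,z)$ with $0\leq x\leq y\leq z$ and $z\geq x+1$ such that $F(x,y,z)=n$. -}

module Defs where

open import Data.Integer hiding (suc)
open import Data.Integer.Divisibility using (_∣_)
open import Data.Integer.Properties
open import Data.Integer.Tactic.RingSolver using (solve-∀)
open import Data.List.Base using (List; length; map; filter; upTo; cartesianProduct)
open import Data.List.Membership.Propositional using (_∈_)
open import Data.List.Membership.Propositional.Properties
  using (∈-map⁺; ∈-upTo⁺; ∈-cartesianProduct⁺; ∈-filter⁺; ∈-filter⁻)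
open import Data.List.Relation.Unary.Unique.Propositional using (Unique)
import Data.List.Relation.Unary.Unique.Propositional.Properties as Unique
open import Data.Nat.Base as ℕ using (ℕ; zero; suc; z≤n; s≤s)
import Data.Nat.Properties as ℕ
open import Data.Product.Base using (_×_; _,_; proj₂)
open import Data.Sum.Base using (_⊎_)
open import Function.Bundles using (_⇔_; mk⇔)
open import Relation.Binary.PropositionalEquality
open import Relation.Nullary.Decidable using (_×-dec_)
open import Relation.Unary using (Decidable)

F : ℤ → ℤ → ℤ → ℤ
F x y z = x ^ 3 + y ^ 3 + z ^ 3 - + 3 * x * y * z

infix 4 _≡_[mod_] _≡±_[mod_]

_≡_[mod_] : ℤ → ℤ → ℤ → Set
a ≡ b [mod m ] = m ∣ a - b

_≡±_[mod_] : ℤ → ℤ → ℤ → Set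
a ≡± b [mod m ] = a ≡ b [mod m ] ⊎ a ≡ - b [mod m ]

IsSolution : ℕ → ℤ × ℤ × ℤ → Set
IsSolution n (x , y , z) =
  0ℤ ≤ x × x ≤ y × y ≤ z × z ≥ x + 1ℤ × F x y z ≡ + n

isSolution? : ∀ n → Decidable (IsSolution n)
isSolution? n (x , y , z) =
  0ℤ ≤? x ×-dec x ≤? y ×-dec y ≤? z ×-dec x + 1ℤ ≤? z ×-dec F x y z ≟ + n

range : ℕ → List ℤ
range n = map +_ (upTo (suc n))

box : ℕ → List (ℤ × ℤ × ℤ)
box n = cartesianProduct (range n) (cartesianProduct (range n) (range n))

-- Every solution has entries in {0, …, n}, so the search below misses
-- none: see ∈-solutions and solutions-unique.
solutions : ℕ → List (ℤ × ℤ × ℤ)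
solutions n = filter (isSolution? n) (box n)

ν : ℕ → ℕ
ν n = length (solutions n)

private
  F-shift : ∀ a d k → F a (a + d) (a + d + k) ≡
            (a + d + k + (a + a + d)) * (d * d + d * k + k * k)
  F-shift = lemma
    where
    lemma : ∀ a d k →
      a * (a * (a * 1ℤ)) + (a + d) * ((a + d) * ((a + d) * 1ℤ))
        + (a + d + k) * ((a + d + k) * ((a + d + k) * 1ℤ))
        - + 3 * a * (a + d) * (a + d + k) ≡
      (a + d + k + (a + a + d)) * (d * d + d * k + k * k)
    lemma = solve-∀

  quadratic-pos : ∀ d k → 1 ℕ.≤ d ℕ.+ k →
                  1 ℕ.≤ d ℕ.* d ℕ.+ d ℕ.* k ℕ.+ k ℕ.* k
  quadratic-pos (suc d) k       _ = s≤s z≤n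
  quadratic-pos zero    (suc k) _ = s≤s z≤n

  bound-ℕ : ∀ n a d k → 1 ℕ.≤ d ℕ.+ k →
            F (+ a) (+ (a ℕ.+ d)) (+ (a ℕ.+ d ℕ.+ k)) ≡ + n →
            a ℕ.+ d ℕ.+ k ℕ.≤ n
  bound-ℕ n a d k 1≤d+k F≡n = begin
    a ℕ.+ d ℕ.+ k  ≤⟨ ℕ.m≤m+n _ _ ⟩
    s              ≡⟨ ℕ.*-identityʳ s ⟨
    s ℕ.* 1        ≤⟨ ℕ.*-monoʳ-≤ s (quadratic-pos d k 1≤d+k) ⟩
    s ℕ.* q        ≡⟨ +-injective s*q≡n ⟩
    n              ∎
    where
    open ℕ.≤-Reasoning
    s = a ℕ.+ d ℕ.+ k ℕ.+ (a ℕ.+ a ℕ.+ d)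
    q = d ℕ.* d ℕ.+ d ℕ.* k ℕ.+ k ℕ.* k
    +q : + q ≡ + d * + d + + d * + k + + k * + k
    +q = cong₂ _+_ (cong₂ _+_ (pos-* d d) (pos-* d k)) (pos-* k k)
    s*q≡n : + (s ℕ.* q) ≡ + n
    s*q≡n = trans (pos-* s q) (trans (cong (+ s *_) +q)
              (trans (sym (F-shift (+ a) (+ d) (+ k))) F≡n))

  z≤bound : ∀ n x y z → IsSolution n (+ x , + y , + z) → z ℕ.≤ n
  z≤bound n x y z (_ , +≤+ x≤y , +≤+ y≤z , +≤+ x+1≤z , F≡n)
    with d , refl ← ℕ.m≤n⇒∃[o]m+o≡n x≤y
    with k , refl ← ℕ.m≤n⇒∃[o]m+o≡n y≤z =
    bound-ℕ n x d k
      (ℕ.+-cancelˡ-≤ x 1 (d ℕ.+ k) (subst (x ℕ.+ 1 ℕ.≤_) (ℕ.+-assoc x d k) x+1≤z))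
      F≡n

  ∈-range : ∀ {m n} → m ℕ.≤ n → + m ∈ range n
  ∈-range m≤n = ∈-map⁺ +_ (∈-upTo⁺ (s≤s m≤n))

  complete : ∀ n t → IsSolution n t → t ∈ solutions n
  complete n (+ x , + y , + z) sol@(_ , +≤+ x≤y , +≤+ y≤z , _) =
    ∈-filter⁺ (isSolution? n)
      (∈-cartesianProduct⁺ (∈-range (ℕ.≤-trans x≤y y≤n))
        (∈-cartesianProduct⁺ (∈-range y≤n) (∈-range z≤n′)))
      sol
    where
    z≤n′ = z≤bound n x y z sol
    y≤n  = ℕ.≤-trans y≤z z≤n′

∈-solutions : ∀ n t → t ∈ solutions n ⇔ IsSolution n t
∈-solutions n t =
  mk⇔ (λ t∈ → proj₂ (∈-filter⁻ (isSolution? n) {xs = box n} t∈)) (complete n t)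

solutions-unique : ∀ n → Unique (solutions n)
solutions-unique n = Unique.filter⁺ (isSolution? n)
  (Unique.cartesianProduct⁺ range! (Unique.cartesianProduct⁺ range! range!))
  where
  range! : Unique (range n)
  range! = Unique.map⁺ +-injective (Unique.upTo⁺ (suc n))

{-# OPTIONS --safe #-}
-- F x y z = S³ − 3 S P, where S = x + y + z and P = x y + y z + z x. Hence
-- 3 ∣ F forces 3 ∣ S and then 9 ∣ F, which excludes n ≡ ±3 (mod 9). The
-- remaining n are reached by the triples (m, m, m + 1), (m, m + 1, m + 1) and
-- (m, m + 1, m + 2), with values 3 m + 1, 3 m + 2 and 9 (m + 1).
module Submission where

open import Defs
open import Data.Empty using (⊥-elim)
open import Data.Fin.Base using (zero; suc)
open import Data.Integer.Base using (+_; 1ℤ; -_; _+_; _-_; _*_; ∣_∣; +≤+)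
open import Data.Integer.Divisibility using (_∣_)
import Data.Integer.Divisibility.Signed as Signed
open import Data.Integer.Properties using (pos-*; abs-*)
open import Data.Integer.Tactic.RingSolver using (solve-∀)
open import Data.List.Base using (List; []; _∷_; length)
open import Data.List.Membership.Propositional using (_∉_)
open import Data.List.Membership.Propositional.Properties using (∈-length)
open import Data.List.Relation.Unary.Any using (here)
open import Data.Nat.Base as ℕ using (ℕ; suc; z≤n; _≥_; _>_)
import Data.Nat.Divisibility as ℕ
open import Data.Nat.DivMod using (_divMod_; result)
open import Data.Nat.Primality using (prime?; euclidsLemma)
import Data.Nat.Properties as ℕ
open import Data.Product.Base using (_×_; _,_)
open import Data.Sum.Base using (_⊎_; inj₁; inj₂; [_,_]; map₂; reduce)
open import Function.Base using (_∘_)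
open import Function.Bundles using (Equivalence)
open import Relation.Binary.PropositionalEquality using (_≡_; refl; sym; trans; cong; subst)
open import Relation.Nullary.Decidable using (from-yes; from-no)
open import Relation.Nullary.Negation using (¬_)

-- The local `lemma` is the same identity with `F` and its cubes unfolded to products, the form on
-- which `solve-∀` works.
F-symmetric : ∀ x y z → F x y z ≡
  (x + y + z) * ((x + y + z) * (x + y + z)) - + 3 * ((x + y + z) * (x * y + y * z + z * x))
F-symmetric = lemma
  where
  lemma : ∀ x y z →
    x * (x * (x * 1ℤ)) + y * (y * (y * 1ℤ)) + z * (z * (z * 1ℤ)) - + 3 * x * y * z ≡
    (x + y + z) * ((x + y + z) * (x + y + z)) - + 3 * ((x + y + z) * (x * y + y * z + z * x))
  lemma = solve-∀

-- With gaps d and k between consecutive entries, `F` factors as (3a + 2d + k)(d² + dk + k²). The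
-- gaps (0,1), (1,0) and (1,1) make the second factor 1, 1 and 3, which gives this identity and the
-- next two.
F[a,a,1+a] : ∀ a → F a a (1ℤ + a) ≡ 1ℤ + a * + 3
F[a,a,1+a] = lemma
  where
  lemma : ∀ a →
    a * (a * (a * 1ℤ)) + a * (a * (a * 1ℤ)) + (1ℤ + a) * ((1ℤ + a) * ((1ℤ + a) * 1ℤ))
      - + 3 * a * a * (1ℤ + a) ≡ 1ℤ + a * + 3
  lemma = solve-∀

F[a,1+a,1+a] : ∀ a → F a (1ℤ + a) (1ℤ + a) ≡ + 2 + a * + 3
F[a,1+a,1+a] = lemma
  where
  lemma : ∀ a →
    a * (a * (a * 1ℤ)) + (1ℤ + a) * ((1ℤ + a) * ((1ℤ + a) * 1ℤ))
      + (1ℤ + a) * ((1ℤ + a) * ((1ℤ + a) * 1ℤ)) - + 3 * a * (1ℤ + a) * (1ℤ + a) ≡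
    + 2 + a * + 3
  lemma = solve-∀

F[a,1+a,2+a] : ∀ a → F a (1ℤ + a) (+ 2 + a) ≡ + 9 + a * + 9
F[a,1+a,2+a] = lemma
  where
  lemma : ∀ a →
    a * (a * (a * 1ℤ)) + (1ℤ + a) * ((1ℤ + a) * ((1ℤ + a) * 1ℤ))
      + (+ 2 + a) * ((+ 2 + a) * ((+ 2 + a) * 1ℤ)) - + 3 * a * (1ℤ + a) * (+ 2 + a) ≡
    + 9 + a * + 9
  lemma = solve-∀

private
  pos-+-* : ∀ r m k → + r + + m * + k ≡ + (r ℕ.+ m ℕ.* k)
  pos-+-* r m k = cong (λ i → + r + i) (sym (pos-* m k))

  m+1≤1+m : ∀ m → m ℕ.+ 1 ℕ.≤ suc m
  m+1≤1+m m = ℕ.≤-reflexive (ℕ.+-comm m 1)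

solution-1+3m : ∀ m → IsSolution (1 ℕ.+ m ℕ.* 3) (+ m , + m , + suc m)
solution-1+3m m =
  +≤+ z≤n , +≤+ ℕ.≤-refl , +≤+ (ℕ.n≤1+n m) , +≤+ (m+1≤1+m m) ,
  trans (F[a,a,1+a] (+ m)) (pos-+-* 1 m 3)

solution-2+3m : ∀ m → IsSolution (2 ℕ.+ m ℕ.* 3) (+ m , + suc m , + suc m)
solution-2+3m m =
  +≤+ z≤n , +≤+ (ℕ.n≤1+n m) , +≤+ ℕ.≤-refl , +≤+ (m+1≤1+m m) ,
  trans (F[a,1+a,1+a] (+ m)) (pos-+-* 2 m 3)

solution-9+9m : ∀ m → IsSolution (9 ℕ.+ m ℕ.* 9) (+ m , + suc m , + suc (suc m))
solution-9+9m m =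
  +≤+ z≤n , +≤+ (ℕ.n≤1+n m) , +≤+ (ℕ.n≤1+n (suc m)) , +≤+ (ℕ.m≤n⇒m≤1+n (m+1≤1+m m)) ,
  trans (F[a,1+a,2+a] (+ m)) (pos-+-* 9 m 9)

solution⇒ν≥1 : ∀ {n t} → IsSolution n t → ν n ≥ 1
solution⇒ν≥1 {n} {t} sol = ∈-length (Equivalence.from (∈-solutions n t) sol)

all-∉⇒length≡0 : ∀ {A : Set} {xs : List A} → (∀ x → x ∉ xs) → length xs ≡ 0
all-∉⇒length≡0 {xs = []}     _ = refl
all-∉⇒length≡0 {xs = x ∷ xs} ∉ = ⊥-elim (∉ x (here refl))

no-solution⇒ν≡0 : ∀ {n} → (∀ t → ¬ IsSolution n t) → ν n ≡ 0
no-solution⇒ν≡0 {n} none =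
  all-∉⇒length≡0 (λ t t∈ → none t (Equivalence.to (∈-solutions n t) t∈))

3∣i*j⇒3∣i⊎3∣j : ∀ i j → + 3 ∣ i * j → (+ 3 ∣ i) ⊎ (+ 3 ∣ j)
3∣i*j⇒3∣i⊎3∣j i j 3∣ij =
  euclidsLemma ∣ i ∣ ∣ j ∣ (from-yes (prime? 3)) (subst (3 ℕ.∣_) (abs-* i j) 3∣ij)

-- Euclid's lemma for the prime 3, applied twice; `reduce` merges the coinciding alternatives.
3∣i³⇒3∣i : ∀ i → + 3 ∣ i * (i * i) → + 3 ∣ i
3∣i³⇒3∣i i = reduce ∘ map₂ (reduce ∘ 3∣i*j⇒3∣i⊎3∣j i i) ∘ 3∣i*j⇒3∣i⊎3∣j i (i * i)

3∣F⇒9∣F : ∀ x y z → + 3 Signed.∣ F x y z → + 9 Signed.∣ F x y z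
3∣F⇒9∣F x y z 3∣F = subst (+ 9 Signed.∣_) (sym F≡) (9∣ s 3∣s)
  where
  s = x + y + z
  p = x * y + y * z + z * x

  F≡ : F x y z ≡ s * (s * s) - + 3 * (s * p)
  F≡ = F-symmetric x y z

  -- Both `F x y z` and `+ 3 * (s * p)` are multiples of 3, hence so is their sum, the cube of `s`.
  3∣s : + 3 Signed.∣ s
  3∣s = Signed.∣ᵤ⇒∣ (3∣i³⇒3∣i s (Signed.∣⇒∣ᵤ {i = s * (s * s)}
    (Signed.∣m+n∣n⇒∣m (subst (+ 3 Signed.∣_) F≡ 3∣F)
      (Signed.∣m⇒∣-m (Signed.∣m⇒∣m*n (s * p) Signed.∣-refl)))))

  -- Here `s` is a variable, so that it can be replaced by `q * + 3`; the two terms become 27q³ and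
  -- 9qp.
  9∣ : ∀ s → + 3 Signed.∣ s → + 9 Signed.∣ (s * (s * s) - + 3 * (s * p))
  9∣ _ (Signed.divides q refl) =
    Signed.divides (+ 3 * (q * (q * q)) - q * p) (lemma q p)
    where
    lemma : ∀ q p → q * + 3 * (q * + 3 * (q * + 3)) - + 3 * (q * + 3 * p) ≡
                    (+ 3 * (q * (q * q)) - q * p) * + 9
    lemma = solve-∀

F≢±3[mod9] : ∀ x y z → ¬ (F x y z ≡± + 3 [mod + 9 ])
F≢±3[mod9] x y z =
  -- The congruences to 3 and -3 say that 9 divides `F x y z + r` with r = -3 and r = 3
  -- respectively.
  [ excluded (- + 3) ℕ.∣-refl (from-no (9 ℕ.∣? 3))
  , excluded (+ 3) ℕ.∣-refl (from-no (9 ℕ.∣? 3)) ]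
  where
  -- If 9 divides the sum, then 3 divides `F x y z`, so 9 does too, and therefore 9 divides `r`.
  excluded : ∀ r → + 3 ∣ r → ¬ (+ 9 ∣ r) → ¬ (+ 9 ∣ F x y z + r)
  excluded r 3∣r 9∤r 9∣F+r =
    9∤r (Signed.∣⇒∣ᵤ (Signed.∣m+n∣m⇒∣n 9∣F+r′ (3∣F⇒9∣F x y z 3∣F)))
    where
    9∣F+r′ : + 9 Signed.∣ F x y z + r
    9∣F+r′ = Signed.∣ᵤ⇒∣ 9∣F+r
    3∣F : + 3 Signed.∣ F x y z
    3∣F = Signed.∣m+n∣n⇒∣m
      (Signed.∣-trans (Signed.divides (+ 3) refl) 9∣F+r′) (Signed.∣ᵤ⇒∣ 3∣r)

ν[9m]≥1 : ∀ m → m ℕ.* 9 > 0 → ν (m ℕ.* 9) ≥ 1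
-- Positivity rules out the multiplier 0, and the index drops by one because the family starts at 9.
ν[9m]≥1 (suc m) _ = solution⇒ν≥1 (solution-9+9m m)

3+9m≡3 : ∀ m → + (3 ℕ.+ m ℕ.* 9) ≡ + 3 [mod + 9 ]
3+9m≡3 m = ℕ.divides m refl

6+9m≡-3 : ∀ m → + (6 ℕ.+ m ℕ.* 9) ≡ - + 3 [mod + 9 ]
-- Subtracting -3 gives 9 + 9m, whence the quotient `suc m`.
6+9m≡-3 m = ℕ.divides (suc m) (ℕ.+-comm (6 ℕ.+ m ℕ.* 9) 3)

ν[3m]≥1 : ∀ m → m ℕ.* 3 > 0 → ¬ (+ (m ℕ.* 3) ≡± + 3 [mod + 9 ]) → ν (m ℕ.* 3) ≥ 1
ν[3m]≥1 m 3m>0 3m≢±3 with m divMod 3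
-- For m = r + 3q the number is 3r + 9q: r = 0 gives a multiple of 9, while r = 1 and r = 2 give the
-- excluded classes 3 and -3.
... | result q zero             refl rewrite ℕ.*-assoc q 3 3 = ν[9m]≥1 q 3m>0
... | result q (suc zero)       refl rewrite ℕ.*-assoc q 3 3 = ⊥-elim (3m≢±3 (inj₁ (3+9m≡3 q)))
... | result q (suc (suc zero)) refl rewrite ℕ.*-assoc q 3 3 = ⊥-elim (3m≢±3 (inj₂ (6+9m≡-3 q)))

n≢±3⇒ν≥1 : ∀ n → n > 0 → ¬ (+ n ≡± + 3 [mod + 9 ]) → ν n ≥ 1
n≢±3⇒ν≥1 n n>0 n≢±3 with n divMod 3
... | result m zero             refl = ν[3m]≥1 m n>0 n≢±3
... | result m (suc zero)       refl = solution⇒ν≥1 (solution-1+3m m)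
... | result m (suc (suc zero)) refl = solution⇒ν≥1 (solution-2+3m m)

proposition3 : (∀ (n : ℕ) → n > 0 → ¬ (+ n ≡± + 3 [mod + 9 ]) → ν n ≥ 1)
    × (∀ (n : ℕ) → n > 0 → + n ≡± + 3 [mod + 9 ] → ν n ≡ 0)
proposition3 =
  n≢±3⇒ν≥1 ,
  λ n _ n≡±3 → no-solution⇒ν≡0 λ where
    (x , y , z) (_ , _ , _ , _ , F≡n) →
      F≢±3[mod9] x y z (subst (_≡± + 3 [mod + 9 ]) (sym F≡n) n≡±3)
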